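{- The tolerant learning hierarchy $\mathsf{TLH}$ is not an upper semilattice. In fact, there are equivalence relations $E^{\mathrm{ce}}$ and $F^{\mathrm{ce}}$ on $\omega$ extending $=^{\mathrm{ce}}$ such that the set $$\bigl\{[D^{\mathrm{ce}}]_{\equiv_{\mathrm{Learn}}}:\ D^{\mathrm{ce}}\in\mathcal{R}^{\mathrm{ce}},\ E^{\mathrm{ce}}\leq_{\mathrm{Learn}}D^{\mathrm{ce}}\text{ and }F^{\mathrm{ce}}\leq_{\mathrm{Learn}}D^{\mathrm{ce}}\bigr\}$$ has no minimal element.
   Context: Fix a standard (acceptable) enumeration $(\varphi_e)_{e\in\omega}$ of the partial computable functions and let $W_e=\operatorname{dom}(\varphi_e)$. Write $e=^{\mathrm{ce}}e'$ iff $W_e=W_{e'}$. Let $\mathcal{R}^{\mathrm{ce}}$ be the set of all equivalence relations on $\omega$ extending $=^{\mathrm{ce}}$ (no definability or effectivity is assumed). An enumeration of a set $A$ is a surjection $\mu:\omega\to A$; $\mu[s]$ denotes the finite string $\mu(0),\dots,\mu(s-1)$. A learner is an arbitrary function $\mathbf{M}:\omega^{<\omega}\to\omega$ (no effectivity is assumed). For $E^{\mathrm{ce}}\in\mathcal{R}^{\mathrm{ce}}$, a family $\mathfrak{K}$ of nonempty c.e. sets is $E^{\mathrm{ce}}$-learnable if there is a learner $\mathbf{M}$ such that for every $e$ with $W_e\in\mathfrak{K}$ and every enumeration $\mu$ of $W_e$ there is $i\in\omega$ with $i\mathrel{E^{\mathrm{ce}}}e$ and $\mathbf{M}(\mu[s])=i$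 for all sufficiently large $s$. $E^{\mathrm{ce}}\leq_{\mathrm{Learn}}F^{\mathrm{ce}}$ means that every $E^{\mathrm{ce}}$-learnable family of nonempty c.e. sets is also $F^{\mathrm{ce}}$-learnable; $E^{\mathrm{ce}}\equiv_{\mathrm{Learn}}F^{\mathrm{ce}}$ means both $E^{\mathrm{ce}}\leq_{\mathrm{Learn}}F^{\mathrm{ce}}$ and $F^{\mathrm{ce}}\leq_{\mathrm{Learn}}E^{\mathrm{ce}}$. The tolerant learning hierarchy $\mathsf{TLH}$ is the poset $(\mathcal{E}^{\mathrm{ce}},\leq)$ where $\mathcal{E}^{\mathrm{ce}}=\mathcal{R}^{\mathrm{ce}}/{\equiv_{\mathrm{Learn}}}$ and $\leq$ is induced by $\leq_{\mathrm{Learn}}$. An upper semilattice is a poset in which any two elements have a least upper bound. -}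

module Defs where

open import Data.Fin.Base using (Fin)
open import Data.List.Base using (List; applyUpTo)
open import Data.Nat.Base using (ℕ; zero; suc; _≤_; _<_)
open import Data.Product.Base using (_×_; ∃)
open import Data.Vec.Base using (Vec; []; _∷_; lookup)
open import Data.Vec.Relation.Binary.Pointwise.Inductive using (Pointwise)
open import Function.Base using (_∘_)
open import Function.Bundles using (_⇔_)
open import Level using (Level; 0ℓ) renaming (suc to lsuc)
open import Relation.Binary.Bundles using (Poset)
open import Relation.Binary.Construct.Interior.Symmetric using (poset)
open import Relation.Binary.Core using (Rel)
open import Relation.Binary.Definitions using (_Respects_)
open import Relation.Binary.PropositionalEquality.Core using (_≡_)
open import Relation.Binary.Structures using (IsEquivalence)
open import Relation.Unary using (Pred; _∈_; _≐_; Satisfiable)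

-- Programs for the n-ary μ-recursive partial functions.
data Rec : ℕ → Set where
  zer  : ∀ {n} → Rec n
  succ : Rec 1
  proj : ∀ {n} → Fin n → Rec n
  comp : ∀ {m n} → Rec m → Vec (Rec n) m → Rec n
  prim : ∀ {n} → Rec n → Rec (suc (suc n)) → Rec (suc n)
  mu   : ∀ {n} → Rec (suc n) → Rec n

-- f [ xs ]⇓ y: the program f halts on input xs with output y.
data _[_]⇓_ : ∀ {n} → Rec n → Vec ℕ n → ℕ → Set where
  zer⇓  : ∀ {n} {xs : Vec ℕ n} → zer [ xs ]⇓ 0
  succ⇓ : ∀ {x} → succ [ x ∷ [] ]⇓ suc x
  proj⇓ : ∀ {n} {i : Fin n} {xs : Vec ℕ n} → proj i [ xs ]⇓ lookup xs i
  comp⇓ : ∀ {m n} {f : Rec m} {gs : Vec (Rec n) m} {xs : Vec ℕ n} {ys : Vec ℕ m} {z} →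
          Pointwise (λ g y → g [ xs ]⇓ y) gs ys → f [ ys ]⇓ z →
          comp f gs [ xs ]⇓ z
  prim⇓-zero : ∀ {n} {f : Rec n} {g : Rec (suc (suc n))} {xs : Vec ℕ n} {y} →
               f [ xs ]⇓ y →
               prim f g [ zero ∷ xs ]⇓ y
  prim⇓-suc  : ∀ {n} {f : Rec n} {g : Rec (suc (suc n))} {xs : Vec ℕ n} {k r y} →
               prim f g [ k ∷ xs ]⇓ r → g [ k ∷ r ∷ xs ]⇓ y →
               prim f g [ suc k ∷ xs ]⇓ y
  mu⇓   : ∀ {n} {f : Rec (suc n)} {xs : Vec ℕ n} {y} →
          (∀ z → z < y → ∃ λ v → f [ z ∷ xs ]⇓ suc v) → f [ y ∷ xs ]⇓ 0 →
          mu f [ xs ]⇓ y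

-- Acceptable enumerations of the unary partial computable functions: φ e x y
-- means φₑ(x)↓ = y.  The universal function is partial computable, and every
-- partial computable ψ(a,x) is φ_{t(a)}(x) for some total computable t.
-- Fixing e, respectively ignoring a, shows that each φₑ is partial computable
-- and that every unary partial computable function occurs as some φₑ.
record AcceptableEnumeration : Set₁ where
  field
    φ         : ℕ → ℕ → ℕ → Set
    universal : ∃ λ (u : Rec 2) → ∀ e x y → φ e x y ⇔ u [ e ∷ x ∷ [] ]⇓ y
    smn       : ∀ (ψ : Rec 2) → ∃ λ (t : ℕ → ℕ) →
                (∃ λ (c : Rec 1) → ∀ a → c [ a ∷ [] ]⇓ t a) ×
                (∀ a x y → φ (t a) x y ⇔ ψ [ a ∷ x ∷ [] ]⇓ y)

  W : ℕ → Pred ℕ 0ℓ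
  W e x = ∃ λ y → φ e x y

  _=ᶜᵉ_ : Rel ℕ 0ℓ
  e =ᶜᵉ e′ = W e ≐ W e′

IsEnumerationOf : Pred ℕ 0ℓ → (ℕ → ℕ) → Set
IsEnumerationOf A μ = (∀ s → μ s ∈ A) × (∀ {x} → x ∈ A → ∃ λ s → μ s ≡ x)

Learner : Set
Learner = List ℕ → ℕ

module Learning (𝓔 : AcceptableEnumeration) where
  open AcceptableEnumeration 𝓔

  record Rᶜᵉ : Set₁ where
    field
      _∼_           : Rel ℕ 0ℓ
      isEquivalence : IsEquivalence _∼_
      extends       : ∀ {e e′} → e =ᶜᵉ e′ → e ∼ e′

  -- Sets are predicates, so a family must be closed under extensional equality.
  record Family : Set₁ where
    field
      member   : Pred (Pred ℕ 0ℓ) 0ℓ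
      respects : member Respects _≐_
      nonempty : ∀ {A} → A ∈ member → Satisfiable A
      ce       : ∀ {A} → A ∈ member → ∃ λ e → A ≐ W e

  Learns : Rᶜᵉ → Family → Learner → Set
  Learns E 𝔎 M =
    ∀ e → W e ∈ member → ∀ μ → IsEnumerationOf (W e) μ →
    ∃ λ i → i ∼ e × (∃ λ s₀ → ∀ s → s₀ ≤ s → M (applyUpTo μ s) ≡ i)
    where
    open Rᶜᵉ E
    open Family 𝔎

  Learnable : Rᶜᵉ → Family → Set
  Learnable E 𝔎 = ∃ λ M → Learns E 𝔎 M

  _≤Learn_ : Rel Rᶜᵉ (lsuc 0ℓ)
  E ≤Learn F = ∀ 𝔎 → Learnable E 𝔎 → Learnable F 𝔎

-- The quotient by ≡Learn is rendered as the poset on Rᶜᵉ whose underlying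
-- equality is mutual ≤Learn.
TLH : AcceptableEnumeration → Poset (lsuc 0ℓ) (lsuc 0ℓ) (lsuc 0ℓ)
TLH 𝓔 = poset {R = _≤Learn_} (λ _ l → l) (λ E≤F F≤G 𝔎 → F≤G 𝔎 ∘ E≤F 𝔎)
  where open Learning 𝓔

module _ {c ℓ₁ ℓ₂ : Level} (P : Poset c ℓ₁ ℓ₂) where
  open Poset P renaming (_≤_ to _⊑_)

  UpperBound : Carrier → Carrier → Pred Carrier ℓ₂
  UpperBound x y z = x ⊑ z × y ⊑ z

  IsLeastUpperBound : Carrier → Carrier → Carrier → Set _
  IsLeastUpperBound x y z = z ∈ UpperBound x y × (∀ w → w ∈ UpperBound x y → z ⊑ w)

  IsUpperSemilattice : Set _
  IsUpperSemilattice = ∀ x y → ∃ λ z → IsLeastUpperBound x y z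

  IsMinimalIn : ∀ {ℓ} → Pred Carrier ℓ → Carrier → Set _
  IsMinimalIn S m = m ∈ S × (∀ x → x ∈ S → x ⊑ m → x ≈ m)

{-# OPTIONS --safe #-}

-- A relation E makes a family learnable exactly when every member A has a
-- finite part such that all members between this part and A are E-equivalent
-- to A.  Hence E ≤Learn F says that, for every A, all sets A′ ⊆ A that agree
-- with A on a long enough initial segment satisfy: A′ E A implies A′ F A.
--
-- Let E identify all infinite sets (and all finite ones), and let F identify
-- the sets with the same least missing element.  An upper bound D must relate
-- ℕ to ℕ ∖ {n} for almost all n, and ℕ ∖ {n} to the finite sets
-- {x ≠ n : x < 2 + n + j} for almost all j.  Detaching from D one such finite
-- set for each n changes nothing close to ℕ ∖ {n}, so the result is still an
-- upper bound; but the detached sets converge to ℕ, so it is strictly below D.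
module Submission where

open import Defs
open import Axiom.ExcludedMiddle using (ExcludedMiddle)
open import Data.Empty using (⊥-elim)
open import Data.Fin.Base using (zero; suc)
open import Data.List.Base using (List; _∷_; applyUpTo)
import Data.List.Membership.Propositional as List
open import Data.List.Membership.Propositional.Properties using (∈-applyUpTo⁺; ∈-applyUpTo⁻)
open import Data.Nat.Base using (ℕ; zero; suc; _+_; _∸_; _⊔_; _≤_; _<_; z≤n; s≤s; z<s; s<s)
open import Data.Nat.Induction using (<-rec)
open import Data.Nat.Properties
open import Data.Product.Base using (_×_; _,_; proj₁; proj₂; ∃; ∃₂)
open import Data.Sum.Base using (inj₁; inj₂)
open import Data.Vec.Base using ([]; _∷_)
open import Data.Vec.Relation.Binary.Pointwise.Inductive using ([]; _∷_)
open import Function.Base using (_∘_; id; const)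
open import Function.Bundles using (_⇔_; mk⇔; Equivalence)
import Function.Construct.Composition as Compose
import Function.Construct.Identity as Identity
import Function.Construct.Symmetry as Symmetry
open import Level using (0ℓ)
open import Relation.Binary.Bundles using (Poset)
open import Relation.Binary.Construct.Interior.Symmetric using (rhs≤lhs)
open import Relation.Binary.Definitions using (_Respects_; tri<; tri≈; tri>)
open import Relation.Binary.PropositionalEquality
  using (_≡_; _≢_; refl; sym; trans; cong; cong₂; subst)
open import Relation.Binary.Structures using (IsEquivalence)
open import Relation.Nullary.Decidable.Core using (Dec; yes; no; decidable-stable)
open import Relation.Nullary.Negation.Core using (¬_; contradiction)
open import Relation.Unary using (Pred; _∈_; _∉_; _⊆_; _≐_; _⊢_; Satisfiable; U)
open import Relation.Unary.Properties using (≐-refl; ≐-sym; ≐-trans)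

open Equivalence using (to; from)

-- Order and limits on ℕ

Least : Pred ℕ 0ℓ → Pred ℕ 0ℓ
Least P n = P n × (∀ {m} → m < n → ¬ P m)

Least-unique : ∀ {P m n} → Least P m → Least P n → m ≡ n
Least-unique {m = m} {n} (Pm , <m) (Pn , <n) with <-cmp m n
... | tri< m<n _ _ = contradiction Pm (<n m<n)
... | tri≈ _ m≡n _ = m≡n
... | tri> _ _ n<m = contradiction Pn (<m n<m)

Eventually : Pred ℕ 0ℓ → Set
Eventually P = ∃ λ s₀ → ∀ s → s₀ ≤ s → P s

Eventually-∩ : ∀ {P Q} → Eventually P → Eventually Q → Eventually (λ s → P s × Q s)
Eventually-∩ (p , P!) (q , Q!) = p ⊔ q , λ s p⊔q≤s →
  P! s (m⊔n≤o⇒m≤o p q p⊔q≤s) , Q! s (m⊔n≤o⇒n≤o p q p⊔q≤s)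

Eventually-map : ∀ {P Q} → P ⊆ Q → Eventually P → Eventually Q
Eventually-map P⊆Q (p , P!) = p , λ s p≤s → P⊆Q (P! s p≤s)

Eventually-∀< : ∀ (P : ℕ → Pred ℕ 0ℓ) b → (∀ {x} → x < b → Eventually (P x)) →
                Eventually (λ s → ∀ {x} → x < b → P x s)
Eventually-∀< P zero    ev = 0 , λ _ _ ()
Eventually-∀< P (suc b) ev = Eventually-map split
  (Eventually-∩ (ev ≤-refl) (Eventually-∀< P b (ev ∘ m<n⇒m<1+n)))
  where
  split : ∀ {s} → P b s × (∀ {x} → x < b → P x s) → ∀ {x} → x < suc b → P x s
  split {s} (Pb , P<b) {x} x<1+b with m<1+n⇒m<n∨m≡n x<1+b
  ... | inj₁ x<b = P<b x<b
  ... | inj₂ x≡b = subst (λ y → P y s) (sym x≡b) Pb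

bounded-image : ∀ (μ : ℕ → ℕ) s → ∃ λ b → ∀ {x} → x < s → μ x < b
bounded-image μ zero    = 0 , λ ()
bounded-image μ (suc s) with bounded-image μ s
... | b , μ<b = suc (μ s) ⊔ b , bound
  where
  bound : ∀ {x} → x < suc s → μ x < suc (μ s) ⊔ b
  bound x<1+s with m<1+n⇒m<n∨m≡n x<1+s
  ... | inj₁ x<s  = m≤n⇒m≤o⊔n (suc (μ s)) (μ<b x<s)
  ... | inj₂ refl = m≤m⊔n (suc (μ s)) b

-- Sets of natural numbers

-- For fixed `B`, these `A` form a basic neighbourhood of `B` among its subsets; the bound `b` codes
-- the finite part of `B` to be contained.
_⊆[_]_ : Pred ℕ 0ℓ → ℕ → Pred ℕ 0ℓ → Set
A ⊆[ b ] B = A ⊆ B × (∀ {x} → x < b → x ∈ B → x ∈ A)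

⊆[]-antitone : ∀ {A B b c} → b ≤ c → A ⊆[ c ] B → A ⊆[ b ] B
⊆[]-antitone b≤c (A⊆B , B⊆A) = A⊆B , λ x<b → B⊆A (<-≤-trans x<b b≤c)

BoundedBy : ℕ → Pred (Pred ℕ 0ℓ) 0ℓ
BoundedBy b A = ∀ {x} → x ∈ A → x < b

Bounded : Pred (Pred ℕ 0ℓ) 0ℓ
Bounded A = ∃ λ b → BoundedBy b A

-- Bounded sets are isolated among their subsets, so only unbounded sets constrain the comparison of
-- two relations.
⊆[]⇒≐ : ∀ {A B b} → BoundedBy b B → A ⊆[ b ] B → A ≐ B
⊆[]⇒≐ B<b (A⊆B , B⊆A) = A⊆B , λ x∈B → B⊆A (B<b x∈B) x∈B

Bounded-respects : Bounded Respects _≐_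
Bounded-respects (_ , B⊆A) (b , A<b) = b , A<b ∘ B⊆A

LeastMissing : ℕ → Pred (Pred ℕ 0ℓ) 0ℓ
LeastMissing n A = Least (_∉ A) n

LeastMissing-respects : ∀ {n} → LeastMissing n Respects _≐_
LeastMissing-respects (A⊆B , B⊆A) (n∉A , <n) =
  n∉A ∘ B⊆A , λ m<n m∉B → <n m<n (m∉B ∘ A⊆B)

⇔-respected : ∀ {P : Pred (Pred ℕ 0ℓ) 0ℓ} → P Respects _≐_ → ∀ {A B} → A ≐ B → P A ⇔ P B
⇔-respected resp A≐B = mk⇔ (resp A≐B) (resp (≐-sym A≐B))

Punctured : ℕ → Pred ℕ 0ℓ
Punctured n x = x ≢ n

-- The summand 2 keeps `1 + n` inside even for `j = 0`, so the set is never empty.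
Block : ℕ → ℕ → Pred ℕ 0ℓ
Block n j x = x ≢ n × x < 2 + n + j

1+n∈Block : ∀ n j → suc n ∈ Block n j
1+n∈Block n j = 1+n≢n , s≤s (s≤s (m≤m+n n j))

leastMissing-Punctured : ∀ n → LeastMissing n (Punctured n)
leastMissing-Punctured n = (λ n≢n → n≢n refl) , λ m<n m∉ → m∉ (<⇒≢ m<n)

leastMissing-Block : ∀ n j → LeastMissing n (Block n j)
leastMissing-Block n j = (λ (n≢n , _) → n≢n refl) , λ m<n m∉ →
  m∉ (<⇒≢ m<n , m<n⇒m<1+n (m<n⇒m<1+n (m≤n⇒m≤n+o j m<n)))

Punctured-unbounded : ∀ n → ¬ Bounded (Punctured n)
Punctured-unbounded n (b , <b) = <-irrefl refl
  (≤-<-trans (m≤n⇒m≤o+n (suc n) ≤-refl) (<b {suc n + b} (m≢1+m+n n ∘ sym)))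

Punctured⊆[]U : ∀ {b n} → b ≤ n → Punctured n ⊆[ b ] U
Punctured⊆[]U b≤n = _ , λ x<b _ → <⇒≢ (<-≤-trans x<b b≤n)

Block⊆[]U : ∀ {b n} j → b ≤ n → Block n j ⊆[ b ] U
Block⊆[]U {n = n} j b≤n = _ , λ x<b _ →
  let x<n = <-≤-trans x<b b≤n in
  <⇒≢ x<n , m<n⇒m<1+n (m<n⇒m<1+n (m≤n⇒m≤n+o j x<n))

Block⊆[]Punctured : ∀ n j → Block n j ⊆[ j ] Punctured n
Block⊆[]Punctured n j = proj₁ , λ x<j x≢n → x≢n , m≤n⇒m≤o+n (2 + n) x<j

-- Enumerations

AgreeBelow : ℕ → (ℕ → ℕ) → (ℕ → ℕ) → Set
AgreeBelow s μ ν = ∀ {x} → x < s → μ x ≡ ν x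

applyUpTo-cong : ∀ s {μ ν : ℕ → ℕ} → AgreeBelow s μ ν → applyUpTo μ s ≡ applyUpTo ν s
applyUpTo-cong zero    μ≗ν = refl
applyUpTo-cong (suc s) μ≗ν = cong₂ _∷_ (μ≗ν z<s) (applyUpTo-cong s (μ≗ν ∘ s<s))

-- After the prefix, `ν` starts from its first value, so surjectivity is inherited from `ν` alone.
splice : ℕ → (ℕ → ℕ) → (ℕ → ℕ) → ℕ → ℕ
splice zero    μ ν x       = ν x
splice (suc s) μ ν zero    = μ zero
splice (suc s) μ ν (suc x) = splice s (μ ∘ suc) ν x

splice-< : ∀ s μ ν → AgreeBelow s (splice s μ ν) μ
splice-< (suc s) μ ν {zero}  _         = refl
splice-< (suc s) μ ν {suc x} (s<s x<s) = splice-< s (μ ∘ suc) ν x<s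

splice-+ : ∀ s μ ν x → splice s μ ν (s + x) ≡ ν x
splice-+ zero    μ ν x = refl
splice-+ (suc s) μ ν x = splice-+ s (μ ∘ suc) ν x

splice-∈ : ∀ {A : Pred ℕ 0ℓ} s μ ν → (∀ {x} → x < s → μ x ∈ A) → (∀ x → ν x ∈ A) →
           ∀ x → splice s μ ν x ∈ A
splice-∈     zero    μ ν μ∈A ν∈A x       = ν∈A x
splice-∈     (suc s) μ ν μ∈A ν∈A zero    = μ∈A z<s
splice-∈ {A} (suc s) μ ν μ∈A ν∈A (suc x) = splice-∈ {A} s (μ ∘ suc) ν (μ∈A ∘ s<s) ν∈A x

splice-enumerates : ∀ {A : Pred ℕ 0ℓ} s μ ν → (∀ {x} → x < s → μ x ∈ A) →
                    IsEnumerationOf A ν → IsEnumerationOf A (splice s μ ν)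
splice-enumerates {A} s μ ν μ∈A (ν∈A , ν-onto) = splice-∈ {A} s μ ν μ∈A ν∈A , λ x∈A →
  let i , νi≡x = ν-onto x∈A in s + i , trans (splice-+ s μ ν i) νi≡x

-- Programs

constant : ∀ {n} → ℕ → Rec n
constant zero    = zer
constant (suc c) = comp succ (constant c ∷ [])

constant-⇓ : ∀ {n} c {xs} → constant {n} c [ xs ]⇓ c
constant-⇓ zero    = zer⇓
constant-⇓ (suc c) = comp⇓ (constant-⇓ c ∷ []) succ⇓

constant-⇓⁻¹ : ∀ {n} c {xs y} → constant {n} c [ xs ]⇓ y → y ≡ c
constant-⇓⁻¹ zero    zer⇓                      = refl
constant-⇓⁻¹ (suc c) (comp⇓ (c⇓ ∷ []) succ⇓) = cong suc (constant-⇓⁻¹ c c⇓)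

Computes : Rec 1 → (ℕ → ℕ) → Set
Computes p χ = ∀ x y → p [ x ∷ [] ]⇓ y ⇔ y ≡ χ x

-- Induction on `N`: primitive recursion serves as a case split, with a constant at 0 and the
-- predecessor passed to a program for the shifted function.
eventuallyConstant⇒computable : ∀ N χ → (∀ x → N ≤ x → χ x ≡ χ N) → ∃ λ p → Computes p χ
eventuallyConstant⇒computable zero χ const-χ = constant (χ 0) , λ x y → mk⇔
  (λ p⇓y → trans (constant-⇓⁻¹ (χ 0) p⇓y) (sym (const-χ x z≤n)))
  (λ { refl → subst (constant (χ 0) [ x ∷ [] ]⇓_) (sym (const-χ x z≤n)) (constant-⇓ (χ 0)) })
eventuallyConstant⇒computable (suc N) χ const-χ
  with p , p-computes ← eventuallyConstant⇒computable N (χ ∘ suc) (λ x → const-χ (suc x) ∘ s≤s)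
  = q , λ x y → mk⇔ (sound x) (λ { refl → complete x })
  where
  q : Rec 1
  q = prim (constant (χ 0)) (comp p (proj zero ∷ []))

  sound : ∀ x {y} → q [ x ∷ [] ]⇓ y → y ≡ χ x
  sound zero    (prim⇓-zero 0⇓)                     = constant-⇓⁻¹ (χ 0) 0⇓
  sound (suc x) (prim⇓-suc _ (comp⇓ (proj⇓ ∷ []) p⇓)) = to (p-computes x _) p⇓

  complete : ∀ x → q [ x ∷ [] ]⇓ χ x
  complete zero    = prim⇓-zero (constant-⇓ (χ 0))
  complete (suc x) = prim⇓-suc (complete x) (comp⇓ (proj⇓ ∷ []) (from (p-computes x _) refl))

-- Consequences of excluded middle

module _ (em : ExcludedMiddle 0ℓ) where

  least : ∀ (P : Pred ℕ 0ℓ) n → P n → ∃ (Least P)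
  least P = <-rec _ λ n rec Pn → case n rec Pn (em {∃ λ m → m < n × P m})
    where
    case : ∀ n → (∀ {m} → m < n → P m → ∃ (Least P)) → P n →
           Dec (∃ λ m → m < n × P m) → ∃ (Least P)
    case n rec Pn (yes (m , m<n , Pm)) = rec m<n Pm
    case n rec Pn (no ¬<n)             = n , Pn , λ m<n Pm → ¬<n (_ , m<n , Pm)

  unbounded-above : ∀ {A} → ¬ Bounded A → ∀ b → ∃ λ x → x ∈ A × b ≤ x
  unbounded-above unb b = decidable-stable em λ ¬∃ →
    unb (b , λ x∈A → ≰⇒> λ b≤x → ¬∃ (_ , x∈A , b≤x))

  enumerate : ∀ {A} → Satisfiable A → ∃ (IsEnumerationOf A)
  enumerate {A} (a , a∈A) =
    (λ x → pick x em) , (λ x → pick-∈ x em) , λ {x} x∈A → x , pick-≡ x∈A em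
    where
    pick : ∀ x → Dec (x ∈ A) → ℕ
    pick x (yes _) = x
    pick x (no _)  = a

    pick-∈ : ∀ x d → pick x d ∈ A
    pick-∈ x (yes x∈A) = x∈A
    pick-∈ x (no _)    = a∈A

    pick-≡ : ∀ {x} → x ∈ A → ∀ d → pick x d ≡ x
    pick-≡ x∈A (yes _)  = refl
    pick-≡ x∈A (no x∉A) = contradiction x∈A x∉A

  -- Locking sequences

  module _ {A : Pred ℕ 0ℓ} (M : Learner) where

    -- The string and its extensions are prefixes of enumerations of `A`, so their entries lie in
    -- `A` automatically.
    Locking : (ℕ → ℕ) → ℕ → Set
    Locking μ s = ∀ μ′ → IsEnumerationOf A μ′ → AgreeBelow s μ′ μ →
                  ∀ t → s ≤ t → M (applyUpTo μ′ t) ≡ M (applyUpTo μ s)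

    -- If no initial segment is locking, it can be extended again and again so
    -- that M changes its mind; the limit is an enumeration on which M diverges.
    module Diverge {ν : ℕ → ℕ} (ν-enum : IsEnumerationOf A ν)
                   (¬locking : ∀ μ → IsEnumerationOf A μ → ∀ s → ¬ Locking μ s) where

      record Revision (μ : ℕ → ℕ) (s : ℕ) : Set where
        field
          μ′     : ℕ → ℕ
          enum   : IsEnumerationOf A μ′
          agree  : AgreeBelow s μ′ μ
          t      : ℕ
          s≤t    : s ≤ t
          change : M (applyUpTo μ′ t) ≢ M (applyUpTo μ s)

      revise : ∀ μ → IsEnumerationOf A μ → ∀ s → Revision μ s
      revise μ enum s = decidable-stable em λ ¬rev →
        ¬locking μ enum s λ μ′ enum′ agree t s≤t →
          decidable-stable em λ change → ¬rev record
            { μ′ = μ′ ; enum = enum′ ; agree = agree ; t = t ; s≤t = s≤t ; change = change }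

      State : Set
      State = ∃ (IsEnumerationOf A) × ℕ

      stage : ℕ → State

      rev : ∀ k → let ((μ , _) , s) = stage k in Revision μ s
      rev k = let ((μ , enum) , s) = stage k in revise μ enum s

      module Rev k = Revision (rev k)

      position : ∀ k → ∃ λ i → Rev.μ′ k i ≡ ν k
      position k = proj₂ (Rev.enum k) (proj₁ ν-enum k)

      stage zero    = (ν , ν-enum) , 0
      -- The new prefix is long enough to preserve the change of mind at `t` and to contain an
      -- occurrence of `ν k`, which makes the limit onto.
      stage (suc k) = (Rev.μ′ k , Rev.enum k) , suc (Rev.t k + proj₁ (position k))

      μ[_] : ℕ → ℕ → ℕ
      μ[ k ] = proj₁ (proj₁ (stage k))

      len : ℕ → ℕ
      len k = proj₂ (stage k)

      t<len : ∀ k → Rev.t k < len (suc k)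
      t<len k = s≤s (m≤m+n (Rev.t k) _)

      len-suc : ∀ k → len k < len (suc k)
      len-suc k = ≤-<-trans (Rev.s≤t k) (t<len k)

      k≤len : ∀ k → k ≤ len k
      k≤len zero    = z≤n
      k≤len (suc k) = ≤-<-trans (k≤len k) (len-suc k)

      stable-+ : ∀ k d → AgreeBelow (len k) μ[ d + k ] μ[ k ]
      len-+ : ∀ k d → len k ≤ len (d + k)
      len-+ k zero    = ≤-refl
      len-+ k (suc d) = ≤-trans (len-+ k d) (<⇒≤ (len-suc (d + k)))
      stable-+ k zero    x<len = refl
      stable-+ k (suc d) x<len =
        trans (Rev.agree (d + k) (<-≤-trans x<len (len-+ k d))) (stable-+ k d x<len)

      stable : ∀ {k l} → k ≤ l → AgreeBelow (len k) μ[ l ] μ[ k ]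
      stable {k} {l} k≤l {x} x<len = subst (λ m → μ[ m ] x ≡ μ[ k ] x) (m∸n+n≡m k≤l)
        (stable-+ k (l ∸ k) x<len)

      -- Stage `suc x` has fixed more than `x` values, so the value at `x` is final there.
      limit : ℕ → ℕ
      limit x = μ[ suc x ] x

      limit-agrees : ∀ k → AgreeBelow (len k) limit μ[ k ]
      limit-agrees k {x} x<len with ≤-total k (suc x)
      ... | inj₁ k≤1+x = stable k≤1+x x<len
      ... | inj₂ 1+x≤k = sym (stable 1+x≤k (k≤len (suc x)))

      limit-enum : IsEnumerationOf A limit
      limit-enum = (λ x → proj₁ (proj₂ (proj₁ (stage (suc x)))) x) , onto
        where
        onto : ∀ {x} → x ∈ A → ∃ λ i → limit i ≡ x
        onto x∈A with k , νk≡x ← proj₂ ν-enum x∈A =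
          let i , μi≡νk = position k in
          i , trans (limit-agrees (suc k) (s≤s (m≤n+m i (Rev.t k)))) (trans μi≡νk νk≡x)

      -- Let `k` be the alleged point of convergence: the prefixes of lengths `len k` and `t` both
      -- agree with the limit and reach past `k`, yet `M` differs on them.
      limit-diverges : ∀ i → ¬ Eventually (λ s → M (applyUpTo limit s) ≡ i)
      limit-diverges i (k , M≡i) = Rev.change k (trans M≡i-at-t (sym M≡i-at-s))
        where
        k≤t : k ≤ Rev.t k
        k≤t = ≤-trans (k≤len k) (Rev.s≤t k)

        M≡i-at-s : M (applyUpTo μ[ k ] (len k)) ≡ i
        M≡i-at-s = trans (cong M (sym (applyUpTo-cong (len k) (limit-agrees k))))
                         (M≡i (len k) (k≤len k))

        M≡i-at-t : M (applyUpTo (Rev.μ′ k) (Rev.t k)) ≡ i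
        M≡i-at-t = trans
          (cong M (sym (applyUpTo-cong (Rev.t k) λ x<t →
            limit-agrees (suc k) (<-trans x<t (t<len k)))))
          (M≡i (Rev.t k) k≤t)

    abstract
      lockingSequence : Satisfiable A →
        (∀ μ → IsEnumerationOf A μ → ∃ λ i → Eventually (λ s → M (applyUpTo μ s) ≡ i)) →
        ∃₂ λ μ s → IsEnumerationOf A μ × Locking μ s
      lockingSequence sat converges = decidable-stable em λ ¬∃ →
        let open Diverge (proj₂ (enumerate sat)) (λ μ enum s lock → ¬∃ (μ , s , enum , lock))
            i , ev = converges limit limit-enum
        in limit-diverges i ev

  -- Computable enumerability of the sets in the argument

  module _ (𝓔 : AcceptableEnumeration) where
    open AcceptableEnumeration 𝓔
    open Learning 𝓔

    -- An unbounded search whose test ignores the search variable halts exactly when `χ x` is 0.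
    computable⇒ce : ∀ {p χ} → Computes p χ → ∃ λ e → (λ x → χ x ≡ 0) ≐ W e
    computable⇒ce {p} {χ} p-computes =
      -- The inputs are the search variable, the parameter and `x`, in this order; the parameter is
      -- ignored and set to 0 below.
      let t , _ , φt = smn (mu (comp p (proj (suc (suc zero)) ∷ [])))
          toW : ∀ {x} → χ x ≡ 0 → x ∈ W (t 0)
          toW {x} χx≡0 = 0 , from (φt 0 x 0)
            (mu⇓ (λ _ ()) (comp⇓ (proj⇓ ∷ []) (from (p-computes x 0) (sym χx≡0))))
          fromW : ∀ {x} → x ∈ W (t 0) → χ x ≡ 0
          fromW {x} (y , φxy) = halts x (to (φt 0 x y) φxy)
      in t 0 , toW , fromW
      where
      halts : ∀ x {a y} → mu (comp p (proj (suc (suc zero)) ∷ [])) [ a ∷ x ∷ [] ]⇓ y → χ x ≡ 0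
      halts x (mu⇓ _ (comp⇓ (proj⇓ ∷ []) p⇓0)) = sym (to (p-computes x 0) p⇓0)

    abstract
      eventuallyConstant⇒ce : ∀ (A : Pred ℕ 0ℓ) N → (∀ x → N ≤ x → x ∈ A ⇔ N ∈ A) →
                              ∃ λ e → A ≐ W e
      eventuallyConstant⇒ce A N const-A =
        let p , p-computes = eventuallyConstant⇒computable N (λ x → χ (em {x ∈ A}))
                               (λ x N≤x → χ-cong (const-A x N≤x) em em)
            e , χ≐W = computable⇒ce p-computes
        in e , ≐-trans ((λ x∈A → χ-∈ x∈A em) , (λ χ≡0 → ∈-χ em χ≡0)) χ≐W
        where
        χ : ∀ {P : Set} → Dec P → ℕ
        χ (yes _) = 0
        χ (no _)  = 1

        χ-cong : ∀ {P Q : Set} → P ⇔ Q → (p : Dec P) (q : Dec Q) → χ p ≡ χ q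
        χ-cong P⇔Q (yes p) (yes q) = refl
        χ-cong P⇔Q (yes p) (no ¬q) = contradiction (to P⇔Q p) ¬q
        χ-cong P⇔Q (no ¬p) (yes q) = contradiction (from P⇔Q q) ¬p
        χ-cong P⇔Q (no ¬p) (no ¬q) = refl

        χ-∈ : ∀ {P : Set} → P → (d : Dec P) → χ d ≡ 0
        χ-∈ p (yes _) = refl
        χ-∈ p (no ¬p) = contradiction p ¬p

        ∈-χ : ∀ {P : Set} (d : Dec P) → χ d ≡ 0 → P
        ∈-χ (yes p) _ = p

    U-ce : ∃ λ e → U ≐ W e
    U-ce = eventuallyConstant⇒ce U 0 λ _ _ → mk⇔ _ _

    Punctured-ce : ∀ n → ∃ λ e → Punctured n ≐ W e
    Punctured-ce n = eventuallyConstant⇒ce (Punctured n) (suc n) λ x n<x →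
      mk⇔ (λ _ → 1+n≢n) (λ _ → >⇒≢ n<x)

    Block-ce : ∀ n j → ∃ λ e → Block n j ≐ W e
    Block-ce n j = eventuallyConstant⇒ce (Block n j) (2 + n + j) λ x N≤x →
      mk⇔ (λ (_ , x<N) → contradiction x<N (≤⇒≯ N≤x))
          (λ (_ , N<N) → contradiction N<N (<-irrefl refl))

    -- Tell-tales

    module _ (E : Rᶜᵉ) (𝔎 : Family) where
      open Rᶜᵉ E
      open IsEquivalence isEquivalence renaming (sym to ∼-sym; trans to ∼-trans)
      open Family 𝔎

      -- Angluin's tell-tale condition, with equality of sets relaxed to `E`.
      TellTale : ℕ → Pred ℕ 0ℓ
      TellTale e b = ∀ e′ → W e′ ∈ member → W e′ ⊆[ b ] W e → e′ ∼ e

      -- Let `b` bound the entries of a locking sequence for `W e`. A member between this finite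
      -- part and `W e` has an enumeration starting with that sequence, on which `M` must keep the
      -- locked value. That value is thus equivalent to both `e′` and `e`.
      learnable⇒tellTale : Learnable E 𝔎 → ∀ e → W e ∈ member → ∃ (TellTale e)
      learnable⇒tellTale (M , learns) e We∈𝔎
        with μ , s , μ-enum , locking ← lockingSequence M (nonempty We∈𝔎)
               (λ μ enum → let i , _ , ev = learns e We∈𝔎 μ enum in i , ev)
        with b , μ<b ← bounded-image μ s
        = b , λ e′ We′∈𝔎 near → ∼-trans (∼-sym (M≡∼ e′ We′∈𝔎 near))
                                        (M≡∼ e We∈𝔎 (id , λ _ → id))
        where
        M≡∼ : ∀ e′ → W e′ ∈ member → W e′ ⊆[ b ] W e → M (applyUpTo μ s) ∼ e′
        M≡∼ e′ We′∈𝔎 (We′⊆We , We⊆We′)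
          with ν , ν-enum ← enumerate (nonempty We′∈𝔎)
          with i , i∼e′ , s₀ , M≡i ← learns e′ We′∈𝔎 (splice s μ ν)
                 (splice-enumerates s μ ν (λ x<s → We⊆We′ (μ<b x<s) (proj₁ μ-enum _)) ν-enum)
          = subst (_∼ e′) (trans (sym (M≡i t (m≤n⊔m s s₀))) M-locked) i∼e′
          where
          t : ℕ
          t = s ⊔ s₀

          μ′ μ″ : ℕ → ℕ
          μ′ = splice s μ ν
          -- Returning to `μ` after `t` values gives an enumeration of `W e`, to which locking
          -- applies.
          μ″ = splice t μ′ μ

          μ′∈We : ∀ x → μ′ x ∈ W e
          μ′∈We = splice-∈ {W e} s μ ν (λ _ → proj₁ μ-enum _) (We′⊆We ∘ proj₁ ν-enum)

          M-locked : M (applyUpTo μ′ t) ≡ M (applyUpTo μ s)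
          M-locked = trans
            (cong M (sym (applyUpTo-cong t (splice-< t μ′ μ))))
            (locking μ″ (splice-enumerates t μ′ μ (λ _ → μ′∈We _) μ-enum)
              (λ x<s → trans (splice-< t μ′ μ (<-≤-trans x<s (m≤m⊔n s s₀))) (splice-< s μ ν x<s))
              t (m≤m⊔n s s₀))

      -- The learner conjectures the least index whose set contains the data and
      -- whose tell-tale is contained in the data.
      module _ (tellTale : ∀ e → W e ∈ member → ∃ (TellTale e)) where

        Compatible : Pred ℕ 0ℓ → Pred ℕ 0ℓ
        Compatible C i = ∃ λ (Wi∈𝔎 : W i ∈ member) → C ⊆[ proj₁ (tellTale i Wi∈𝔎) ] W i

        minimize : ∀ {P : Pred ℕ 0ℓ} → Dec (∃ (Least P)) → ℕ
        minimize (yes (i , _)) = i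
        -- An arbitrary default, returned at only finitely many stages when a member is enumerated.
        minimize (no _)        = 0

        minimize-least : ∀ {P i} → Least P i → (d : Dec (∃ (Least P))) → minimize d ≡ i
        minimize-least Pi (yes (_ , Pj)) = Least-unique Pj Pi
        minimize-least Pi (no ¬P)        = contradiction (_ , Pi) ¬P

        learner : Learner
        learner σ = minimize (em {∃ (Least (Compatible (List._∈ σ)))})

        module _ {e μ} (μ-enum : IsEnumerationOf (W e) μ) where

          Data : ℕ → Pred ℕ 0ℓ
          Data s = List._∈ applyUpTo μ s

          Data⊆W : ∀ s → Data s ⊆ W e
          Data⊆W s x∈ with i , _ , refl ← ∈-applyUpTo⁻ μ x∈ = proj₁ μ-enum i

          W⊆Data : ∀ {x} → x ∈ W e → Eventually (λ s → x ∈ Data s)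
          W⊆Data x∈ with i , refl ← proj₂ μ-enum x∈ = suc i , λ s → ∈-applyUpTo⁺ μ

          -- The tell-tale is finite, so all of it has appeared by some stage.
          Compatible-eventually : ∀ {i} → Compatible (W e) i →
                                  Eventually (λ s → Compatible (Data s) i)
          Compatible-eventually {i} (Wi∈𝔎 , We⊆Wi , Wi⊆We) =
            Eventually-map compatible
              (Eventually-∀< (λ x s → x ∈ W i → x ∈ Data s) (proj₁ (tellTale i Wi∈𝔎)) appears)
            where
            compatible : ∀ {s} → (∀ {x} → x < proj₁ (tellTale i Wi∈𝔎) → x ∈ W i → x ∈ Data s) →
                         Compatible (Data s) i
            compatible {s} Wi⊆Data = Wi∈𝔎 , (λ x∈ → We⊆Wi (Data⊆W s x∈)) , Wi⊆Data

            appears : ∀ {x} → x < proj₁ (tellTale i Wi∈𝔎) →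
                      Eventually (λ s → x ∈ W i → x ∈ Data s)
            appears {x} x<b with em {x ∈ W i}
            ... | yes x∈Wi = Eventually-map const (W⊆Data (Wi⊆We x<b x∈Wi))
            ... | no  x∉Wi = 0 , λ _ _ x∈Wi → contradiction x∈Wi x∉Wi

          -- Were i compatible with arbitrarily long data, it would be
          -- compatible with W e itself.
          ¬Compatible-eventually : ∀ {i} → ¬ Compatible (W e) i →
                                   Eventually (λ s → ¬ Compatible (Data s) i)
          ¬Compatible-eventually {i} ¬comp with em {W i ∈ member}
          ... | no  Wi∉𝔎 = 0 , λ _ _ comp → Wi∉𝔎 (proj₁ comp)
          ... | yes Wi∈𝔎 with em {∃ λ k → μ k ∉ W i}
          ...   | yes (k , μk∉Wi) = suc k , λ s k<s (_ , Data⊆Wi , _) →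
                    μk∉Wi (Data⊆Wi (∈-applyUpTo⁺ μ k<s))
          ...   | no  μ∈Wi        = 0 , λ s _ (Wi∈𝔎′ , _ , Wi⊆Data) →
                    ¬comp (Wi∈𝔎′ , We⊆Wi , λ x<b x∈Wi → Data⊆W s (Wi⊆Data x<b x∈Wi))
            where
            We⊆Wi : W e ⊆ W i
            We⊆Wi x∈We with k , refl ← proj₂ μ-enum x∈We =
              decidable-stable em λ μk∉Wi → μ∈Wi (k , μk∉Wi)

          -- The limit is the least index compatible with all of `W e`; one exists because `e` is.
          -- The finitely many smaller indices are eventually refuted, and the tell-tale of `i`,
          -- applied to `W e`, shows that `i` is correct.
          learner-converges : W e ∈ member →
            ∃ λ i → i ∼ e × Eventually (λ s → learner (applyUpTo μ s) ≡ i)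
          learner-converges We∈𝔎
            with i , least-comp@(Wi∈𝔎 , near) , minimal ←
                   least (Compatible (W e)) e (We∈𝔎 , id , λ _ → id)
            = i , ∼-sym (proj₂ (tellTale i Wi∈𝔎) e We∈𝔎 near) ,
              Eventually-map
                (λ {s} (comp-s , minimal-s) →
                  minimize-least {P = Compatible (Data s)} (comp-s , minimal-s) em)
                (Eventually-∩ (Compatible-eventually least-comp)
                  (Eventually-∀< (λ j s → ¬ Compatible (Data s) j) i
                    (¬Compatible-eventually ∘ minimal)))

        tellTale⇒learnable : Learnable E 𝔎
        tellTale⇒learnable = learner , λ e We∈𝔎 μ μ-enum → learner-converges μ-enum We∈𝔎

    -- The local form of ≤Learn

    LocallyBelow : Rᶜᵉ → Rᶜᵉ → Set
    LocallyBelow E F =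
      ∀ e → Satisfiable (W e) → ∃ λ b →
      ∀ e′ → Satisfiable (W e′) → W e′ ⊆[ b ] W e → Rᶜᵉ._∼_ E e′ e → Rᶜᵉ._∼_ F e′ e

    locallyBelow⇒≤Learn : ∀ E F → LocallyBelow E F → E ≤Learn F
    locallyBelow⇒≤Learn E F E≼F 𝔎 E-learns = tellTale⇒learnable F 𝔎 λ e We∈𝔎 →
      let b , near⇒E = learnable⇒tellTale E 𝔎 E-learns e We∈𝔎
          c , E⇒F    = E≼F e (nonempty We∈𝔎)
      in b ⊔ c , λ e′ We′∈𝔎 near →
        E⇒F e′ (nonempty We′∈𝔎) (⊆[]-antitone (m≤n⊔m b c) near)
          (near⇒E e′ We′∈𝔎 (⊆[]-antitone (m≤m⊔n b c) near))
      where open Family 𝔎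

    abstract
      -- The constant learner `e` succeeds up to `E` on the family of all nonempty c.e. sets
      -- equivalent to `W e`; the `F`-tell-tale of `e` in this family is the bound.
      ≤Learn⇒locallyBelow : ∀ E F → E ≤Learn F → LocallyBelow E F
      ≤Learn⇒locallyBelow E F E≤F e We-sat =
        let b , near⇒F = learnable⇒tellTale F class (E≤F class ((λ _ → e) , learns)) e
                           (We-sat , e , ≐-refl , E.refl)
        in b , λ e′ We′-sat near e′∼e → near⇒F e′ (We′-sat , e′ , ≐-refl , e′∼e) near
        where
        open Rᶜᵉ E
        module E = IsEquivalence isEquivalence

        class : Family
        class = record
          { member   = λ A → Satisfiable A × ∃ λ e′ → A ≐ W e′ × e′ ∼ e
          ; respects = λ { A≐B@(A⊆B , _) ((a , a∈A) , e′ , A≐We′ , e′∼e) →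
                           (a , A⊆B a∈A) , e′ , ≐-trans (≐-sym A≐B) A≐We′ , e′∼e }
          ; nonempty = proj₁
          ; ce       = λ (_ , e′ , A≐We′ , _) → e′ , A≐We′
          }

        learns : Learns E class (λ _ → e)
        learns e″ (_ , e′ , We″≐We′ , e′∼e) _ _ =
          e , E.sym (E.trans (extends We″≐We′) e′∼e) , 0 , λ _ _ → refl

    -- The two relations without a minimal upper bound

    ⇔-isEquivalence : ∀ (P : Pred ℕ 0ℓ) → IsEquivalence (λ e e′ → P e ⇔ P e′)
    ⇔-isEquivalence P = record
      { refl  = Identity.⇔-id _
      ; sym   = Symmetry.⇔-sym
      ; trans = λ f g → Compose._⇔-∘_ g f
      }

    SameBoundedness : Rᶜᵉ
    SameBoundedness = record
      { _∼_           = λ e e′ → Bounded (W e) ⇔ Bounded (W e′)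
      ; isEquivalence = ⇔-isEquivalence (W ⊢ Bounded)
      ; extends       = ⇔-respected Bounded-respects
      }

    -- Quantifying over `n` also covers ℕ, which has no least missing element and forms a class of
    -- its own.
    SameLeastMissing : Rᶜᵉ
    SameLeastMissing = record
      { _∼_           = λ e e′ → ∀ n → LeastMissing n (W e) ⇔ LeastMissing n (W e′)
      ; isEquivalence = record
        { refl  = λ n → Identity.⇔-id _
        ; sym   = λ f n → Symmetry.⇔-sym (f n)
        ; trans = λ f g n → Compose._⇔-∘_ (g n) (f n)
        }
      ; extends       = λ e=e′ n → ⇔-respected LeastMissing-respects e=e′
      }

    -- Detaching blocks from an upper bound

    module Detach (D : Rᶜᵉ)
                  (E≤D : SameBoundedness ≤Learn D) (F≤D : SameLeastMissing ≤Learn D) where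
      open Rᶜᵉ D
      open IsEquivalence isEquivalence renaming (refl to ∼-refl; sym to ∼-sym; trans to ∼-trans)

      -- The closeness at which sets with least missing element `n` become `D`-equivalent to
      -- `Punctured n`; it makes the detached block `D`-equivalent to `Punctured n`.
      f : ℕ → ℕ
      f n = let y , P≐Wy = Punctured-ce n in
        proj₁ (≤Learn⇒locallyBelow SameLeastMissing D F≤D y
          (suc n , proj₁ P≐Wy 1+n≢n))

      Detached : Pred (Pred ℕ 0ℓ) 0ℓ
      Detached A = ∃ λ n → A ≐ Block n (f n)

      Detached-respects : Detached Respects _≐_
      Detached-respects A≐B (n , A≐Block) = n , ≐-trans (≐-sym A≐B) A≐Block

      Detached⇒bounded : ∀ {A} → Detached A → Bounded A
      Detached⇒bounded (n , A⊆Block , _) = 2 + n + f n , proj₂ ∘ A⊆Block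

      -- Each `D`-class is split into its detached and its other sets; detached sets in one class
      -- stay related to each other.
      D′ : Rᶜᵉ
      D′ = record
        { _∼_           = λ e e′ → e ∼ e′ × (Detached (W e) ⇔ Detached (W e′))
        ; isEquivalence = record
          { refl  = ∼-refl , R.refl
          ; sym   = λ (p , q) → ∼-sym p , R.sym q
          ; trans = λ (p , q) (p′ , q′) → ∼-trans p p′ , R.trans q q′
          }
        ; extends       = λ e=e′ → extends e=e′ , ⇔-respected Detached-respects e=e′
        }
        where module R = IsEquivalence (⇔-isEquivalence (W ⊢ Detached))

      D′≤D : D′ ≤Learn D
      D′≤D 𝔎 (M , learns) = M , λ e We∈𝔎 μ enum →
        let i , (i∼e , _) , ev = learns e We∈𝔎 μ enum in i , i∼e , ev

      -- At a bounded set nothing but the set itself is close. An unbounded set is not detached, so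
      -- it suffices that close `X`-equivalent sets are not detached either.
      below-D′ : ∀ X → X ≤Learn D →
        (∀ e → ¬ Bounded (W e) → ∃ λ b →
         ∀ e′ → W e′ ⊆[ b ] W e → Rᶜᵉ._∼_ X e′ e → ¬ Detached (W e′)) →
        X ≤Learn D′
      below-D′ X X≤D avoids = locallyBelow⇒≤Learn X D′ local
        where
        local : LocallyBelow X D′
        local e We-sat with em {Bounded (W e)}
        ... | yes (b , We<b) = b , λ e′ _ near _ → Rᶜᵉ.extends D′ (⊆[]⇒≐ We<b near)
        ... | no unbounded =
          let b , X⇒D = ≤Learn⇒locallyBelow X D X≤D e We-sat
              c , avoid = avoids e unbounded
          in b ⊔ c , λ e′ We′-sat near Xe′e →
            X⇒D e′ We′-sat (⊆[]-antitone (m≤m⊔n b c) near) Xe′e ,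
            mk⇔ (⊥-elim ∘ avoid e′ (⊆[]-antitone (m≤n⊔m b c) near) Xe′e)
                (⊥-elim ∘ unbounded ∘ Detached⇒bounded)

      E≤D′ : SameBoundedness ≤Learn D′
      E≤D′ = below-D′ SameBoundedness E≤D λ e unbounded →
        0 , λ e′ _ same → unbounded ∘ to same ∘ Detached⇒bounded

      -- A detached set with least missing element `n` can only be the block of `n`, which is
      -- excluded by requiring one element of `W e` beyond its bound. If nothing is missing from
      -- `W e`, no block is equivalent to it.
      F≤D′ : SameLeastMissing ≤Learn D′
      F≤D′ = below-D′ SameLeastMissing F≤D avoids
        where
        avoids : ∀ e → ¬ Bounded (W e) → ∃ λ b → ∀ e′ → W e′ ⊆[ b ] W e →
                 Rᶜᵉ._∼_ SameLeastMissing e′ e → ¬ Detached (W e′)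
        avoids e unbounded with em {∃ λ n → LeastMissing n (W e)}
        ... | no none = 0 , λ e′ _ same (n , We′≐B) →
          none (n , to (same n) (LeastMissing-respects (≐-sym We′≐B) (leastMissing-Block n (f n))))
        ... | yes (n , n-least) with x , x∈We , N≤x ← unbounded-above unbounded (2 + n + f n)
          -- The successor forces `x` itself into every close set.
          = suc x , avoid
          where
          avoid : ∀ e′ → W e′ ⊆[ suc x ] W e →
                  Rᶜᵉ._∼_ SameLeastMissing e′ e → ¬ Detached (W e′)
          avoid e′ (_ , We⊆We′) same (m , We′≐B)
            with refl ← Least-unique n-least
                   (to (same m) (LeastMissing-respects (≐-sym We′≐B) (leastMissing-Block m (f m))))
            = ≤⇒≯ N≤x (proj₂ (proj₁ We′≐B (We⊆We′ ≤-refl x∈We)))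

      -- Through `Punctured n`, a detached block close to ℕ is `D`-equivalent to ℕ. If `D′`
      -- preserved this, ℕ would be detached, hence equal to a block, but each block omits a number.
      D≰D′ : ¬ D ≤Learn D′
      D≰D′ D≤D′
        with u , U≐Wu ← U-ce
        with b , E⇒D  ← ≤Learn⇒locallyBelow SameBoundedness D E≤D u (0 , proj₁ U≐Wu _)
        with c , D⇒D′ ← ≤Learn⇒locallyBelow D D′ D≤D′ u (0 , proj₁ U≐Wu _)
        = k∉Block (proj₁ U≐Block _)
        where
        n : ℕ
        -- Beyond `b`, `Punctured n` is `D`-equivalent to ℕ; beyond `c`, the block is close enough
        -- to pass from `D` to `D′`.
        n = b ⊔ c

        transport : ∀ {A B d e m} → A ≐ W d → B ≐ W e → A ⊆[ m ] B → W d ⊆[ m ] W e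
        transport (A⊆Wd , Wd⊆A) (B⊆We , We⊆B) (A⊆B , B⊆A) =
          B⊆We ∘ A⊆B ∘ Wd⊆A , λ x<m → A⊆Wd ∘ B⊆A x<m ∘ We⊆B

        y = proj₁ (Punctured-ce n)
        P≐Wy = proj₂ (Punctured-ce n)
        a = proj₁ (Block-ce n (f n))
        B≐Wa = proj₂ (Block-ce n (f n))

        Wy-sat : Satisfiable (W y)
        Wy-sat = suc n , proj₁ P≐Wy 1+n≢n

        Wa-sat : Satisfiable (W a)
        Wa-sat = suc n , proj₁ B≐Wa (1+n∈Block n (f n))

        y∼u : y ∼ u
        y∼u = E⇒D y Wy-sat (transport P≐Wy U≐Wu (Punctured⊆[]U (m≤m⊔n b c)))
          (mk⇔ (⊥-elim ∘ Punctured-unbounded n ∘ Bounded-respects (≐-sym P≐Wy))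
               (λ (d , Wu<d) → contradiction (Wu<d (proj₁ U≐Wu {d} _)) (<-irrefl refl)))

        a∼y : a ∼ y
        -- The bound of this instance is `f n` by definition, so the block is just close enough.
        a∼y = proj₂ (≤Learn⇒locallyBelow SameLeastMissing D F≤D y Wy-sat) a Wa-sat
          (transport B≐Wa P≐Wy (Block⊆[]Punctured n (f n)))
          λ m → mk⇔ (sameLeast B≐Wa P≐Wy (leastMissing-Block n (f n)) (leastMissing-Punctured n))
                    (sameLeast P≐Wy B≐Wa (leastMissing-Punctured n) (leastMissing-Block n (f n)))
          where
          sameLeast : ∀ {A B d e k m} → A ≐ W d → B ≐ W e →
                      LeastMissing k A → LeastMissing k B →
                      LeastMissing m (W d) → LeastMissing m (W e)
          sameLeast A≐Wd B≐We kA kB mWd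
            with refl ← Least-unique mWd (LeastMissing-respects A≐Wd kA)
            = LeastMissing-respects B≐We kB

        u-detached : Detached (W u)
        u-detached = to (proj₂ (D⇒D′ a Wa-sat
          (transport B≐Wa U≐Wu (Block⊆[]U (f n) (m≤n⊔m b c)))
          (∼-trans a∼y y∼u))) (n , ≐-sym B≐Wa)

        k : ℕ
        k = proj₁ u-detached

        U≐Block : U ≐ Block k (f k)
        U≐Block = ≐-trans U≐Wu (proj₂ u-detached)

        k∉Block : k ∉ Block k (f k)
        k∉Block (k≢k , _) = k≢k refl

theorem4p9 : (∀ ℓ → ExcludedMiddle ℓ) → (𝓔 : AcceptableEnumeration) →
    ¬ IsUpperSemilattice (TLH 𝓔) ×
    (∃₂ λ (E F : Poset.Carrier (TLH 𝓔)) →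
    ¬ (∃ λ D → IsMinimalIn (TLH 𝓔) (UpperBound (TLH 𝓔) E F) D))
theorem4p9 em 𝓔 = notSemilattice , E , F , noMinimal
  where
  E F : Poset.Carrier (TLH 𝓔)
  E = SameBoundedness (em 0ℓ) 𝓔
  F = SameLeastMissing (em 0ℓ) 𝓔

  noMinimal : ¬ (∃ λ D → IsMinimalIn (TLH 𝓔) (UpperBound (TLH 𝓔) E F) D)
  noMinimal (D , (E≤D , F≤D) , minimal) = D≰D′ (rhs≤lhs (minimal D′ (E≤D′ , F≤D′) D′≤D))
    where open Detach (em 0ℓ) 𝓔 D E≤D F≤D

  notSemilattice : ¬ IsUpperSemilattice (TLH 𝓔)
  -- A least upper bound of `E` and `F` would be a minimal one.
  notSemilattice lub =
    let D , bound , below = lub E F in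
    noMinimal (D , bound , λ D₁ bound₁ D₁≤D →
      record { lhs≤rhs = D₁≤D ; rhs≤lhs = below D₁ bound₁ })
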